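{- Let $G_1,G_2$ be grammars, $p$ a pattern, $t,u$ terms, $b$ a binding set and $C$ a context. Then: (1) if the entry $(\bullet,b)$ belongs to the list $M_{ev}\,G_1\,(t,p,G_2)$, then $G_1\vdash t:p_{G_2}\mid b$ is derivable; (2) if there exists evidence $ev$ that either ($u=t$ and $C=\mathsf{hole}$) or $u<_{\mathsf{sub}}t$, such that the entry $((C,u)^{ev},b)$ belongs to the list $M_{ev}\,G_1\,(t,p,G_2)$, then $G_1\vdash t=C[u]:p_{G_2}\mid b$ is derivable.
   Context: **Terms and patterns.** Fix sets of literals $a$, pattern variables $x$ and non-terminals $n$, each with decidable equality. Terms $t,u$, list terms $l$, contexts $C$ and list contexts $L$ are mutually inductively generated by $t ::= \mathsf{lit}\,a \mid l \mid C$; $l ::= \mathsf{nil}\mid \mathsf{cons}\;t\;l$; $C ::= \mathsf{hole}\mid L$; $L ::= \mathsf{hd}\;C\;l \mid \mathsf{tl}\;t\;L$ (injections between categories are left implicit). Patterns $p$ and list patterns $q$: $p ::= \mathsf{lit}\,a\mid \mathsf{hole}\mid q\mid \mathsf{name}\,x\,p\mid \mathsf{nt}\,n\mid \mathsf{in\text{ - }hole}\,p_c\,p_h$; $q::=\mathsf{nil}\mid\mathsf{cons}\;p\;q$. A term is structured if it is $\mathsf{cons}\;t_1\;l$, with head $t_1$ and tail $l$; or $\mathsf{hd}\;C\;l$, with head $C$ and tail $l$; or $\mathsf{tl}\;t_1\;L$, with head $t_1$ and tail $L$ (heads and tails viewed as terms). Each possible tail has an underlying list term: $\lfloor l\rfloor=l$,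 $\lfloor \mathsf{hd}\;C\;l\rfloor=\mathsf{cons}\;C\;l$, $\lfloor\mathsf{tl}\;t\;L\rfloor=\mathsf{cons}\;t\;\lfloor L\rfloor$. The relation $u<_{\mathsf{sub}}t$ ($u$ is a proper sub-term of $t$) is the transitive closure of "$u$ is the head or the tail of the structured term $t$". Composition of contexts: $\mathsf{hole}\mathbin{+\!+}C'=C'$, $(\mathsf{hd}\;C\;l)\mathbin{+\!+}C'=\mathsf{hd}\;(C\mathbin{+\!+}C')\;l$, $(\mathsf{tl}\;t\;L)\mathbin{+\!+}C'=\mathsf{tl}\;t\;(L\mathbin{+\!+}C')$. **Grammars and bindings.** A production is a pair $(n,p)$. A grammar $G$ is a finite set of productions; $p\in G(n)$ means $(n,p)\in G$; $G\setminus(n,p)$ is $G$ with $(n,p)$ removed. A binding set $b$ is a finite partial function from pattern variables to terms; $\varnothing$ is the empty one. $b\sqcup b'$ is the union; it is defined only if $b$ and $b'$ agree wherever both are defined. Any rule or expression containing $\sqcup$ applies only when the union is defined. **Judgments.** Matching $G\vdash t:p_{G'}\mid b$ and decomposition $G\vdash t=C[u]:p_{G'}\mid b$ are the least relations closed under the following rules. Matching: - $G\vdash \mathsf{lit}\,a:(\mathsf{lit}\,a)_{G'}\mid\varnothing$; $G\vdash\mathsf{hole}:\mathsf{hole}_{G'}\mid\varnothing$; $G\vdash\mathsf{nil}:\mathsf{nil}_{G'}\mid\varnothing$. - If $G\vdash t:p_{G'}\mid b$ then $G\vdash t:(\mathsf{name}\,x\,p)_{G'}\mid b\sqcup\{(x,t)\}$.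 - If $p\in G'(n)$ and $G\vdash t:p_{G'\setminus(n,p)}\mid b$ then $G\vdash t:(\mathsf{nt}\,n)_{G'}\mid\varnothing$. - If $s$ is structured with head $t_1$ and tail $t_2$, $G\vdash t_1:(p_1)_G\mid b_1$ and $G\vdash t_2:(p_2)_G\mid b_2$, then $G\vdash s:(\mathsf{cons}\,p_1\,p_2)_{G'}\mid b_1\sqcup b_2$. - If $G\vdash t=C[u]:(p_c)_{G'}\mid b_c$, $u<_{\mathsf{sub}}t$ and $G\vdash u:(p_h)_G\mid b_h$, then $G\vdash t:(\mathsf{in\text{ - }hole}\,p_c\,p_h)_{G'}\mid b_c\sqcup b_h$. - If $G\vdash t=\mathsf{hole}[t]:(p_c)_{G'}\mid b_c$ and $G\vdash t:(p_h)_{G'}\mid b_h$, then $G\vdash t:(\mathsf{in\text{ - }hole}\,p_c\,p_h)_{G'}\mid b_c\sqcup b_h$. Decomposition: - $G\vdash t=\mathsf{hole}[t]:\mathsf{hole}_{G'}\mid\varnothing$. - If $s$ is structured with head $t_1$ and tail $t_2$, $G\vdash t_1=C[u]:(p_1)_G\mid b_1$ and $G\vdash t_2:(p_2)_G\mid b_2$, then $G\vdash s=(\mathsf{hd}\;C\;\lfloor t_2\rfloor)[u]:(\mathsf{cons}\,p_1\,p_2)_{G'}\mid b_1\sqcup b_2$. - If $s$ is structured with head $t_1$ and tail $t_2$, $G\vdash t_1:(p_1)_G\mid b_1$ and $G\vdash t_2=C[u]:(p_2)_G\mid b_2$ with $C$ a list context, then $G\vdash s=(\mathsf{tl}\;t_1\;C)[u]:(\mathsf{cons}\,p_1\,p_2)_{G'}\mid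 b_1\sqcup b_2$. - If $p\in G'(n)$ and $G\vdash t=C[u]:p_{G'\setminus(n,p)}\mid b$ then $G\vdash t=C[u]:(\mathsf{nt}\,n)_{G'}\mid\varnothing$. - If $G\vdash t=C_c[t_c]:(p_c)_{G'}\mid b_c$, $t_c<_{\mathsf{sub}}t$ and $G\vdash t_c=C_h[t_h]:(p_h)_G\mid b_h$, then $G\vdash t=(C_c\mathbin{+\!+}C_h)[t_h]:(\mathsf{in\text{ - }hole}\,p_c\,p_h)_{G'}\mid b_c\sqcup b_h$. - If $G\vdash t=\mathsf{hole}[t]:(p_c)_{G'}\mid b_c$ and $G\vdash t=C_h[t_h]:(p_h)_{G'}\mid b_h$, then $G\vdash t=(\mathsf{hole}\mathbin{+\!+}C_h)[t_h]:(\mathsf{in\text{ - }hole}\,p_c\,p_h)_{G'}\mid b_c\sqcup b_h$. - If $G\vdash t=C[u]:p_{G'}\mid b$ then $G\vdash t=C[u]:(\mathsf{name}\,x\,p)_{G'}\mid b\sqcup\{(x,C)\}$. **Algorithm.** $M_{ev}\,g_1\,(t,p,g_2)$ is a finite list of entries $(d,b)$, where $b$ is a binding set and $d$ is either $\bullet$ (a match) or $(C,u)^{ev}$ (a decomposition) with $ev$ evidence that ($u=t$ and $C=\mathsf{hole}$) or $u<_{\mathsf{sub}}t$. It is defined by well-founded recursion on $(t,p,g_2)$ (either $t$ gets $<_{\mathsf{sub}}$-smaller, or $t$ is unchanged and $p$ is replaced by an immediate sub-pattern with the grammar kept, or $t$ is unchanged and a production is removed from $g_2$): - $(\mathsf{hole},\mathsf{hole},g_2)$: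 $[((\mathsf{hole},\mathsf{hole}),\varnothing),(\bullet,\varnothing)]$; for $t\neq\mathsf{hole}$, $(t,\mathsf{hole},g_2)$: $[((\mathsf{hole},t),\varnothing)]$. - $(\mathsf{lit}\,a,\mathsf{lit}\,a,g_2)$ and $(\mathsf{nil},\mathsf{nil},g_2)$: $[(\bullet,\varnothing)]$. - $(s,\mathsf{cons}\,p_1\,p_2,g_2)$, $s$ structured with head $t_1$ and tail $t_2$: all $(d,b_1\sqcup b_2)$ with $(d_1,b_1)\in M_{ev}\,g_1\,(t_1,p_1,g_1)$, $(d_2,b_2)\in M_{ev}\,g_1\,(t_2,p_2,g_1)$, and $d=\bullet$ if $d_1=d_2=\bullet$; $d=(\mathsf{hd}\;C\;\lfloor t_2\rfloor,u)$ if $d_1=(C,u)$ and $d_2=\bullet$; $d=(\mathsf{tl}\;t_1\;C,u)$ if $d_1=\bullet$ and $d_2=(C,u)$; no entry if both are decompositions. - $(t,\mathsf{in\text{ - }hole}\,p_c\,p_h,g_2)$: all $(d,b_c\sqcup b_h)$ with $((C,t_c)^{ev},b_c)\in M_{ev}\,g_1\,(t,p_c,g_2)$, $(d_h,b_h)\in M_{ev}\,g_1\,(t_c,p_h,g_h)$, where $g_h=g_1$ if $ev$ shows $t_c<_{\mathsf{sub}}t$ and $g_h=g_2$ if $ev$ shows $t_c=t$; $d=\bullet$ if $d_h=\bullet$, and $d=(C\mathbin{+\!+}C_h,u)$ if $d_h=(C_h,u)$. - $(t,\mathsf{name}\,x\,p',g_2)$: all $(d,\{(x,v)\}\sqcup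 b)$ with $(d,b)\in M_{ev}\,g_1\,(t,p',g_2)$, where $v=t$ if $d=\bullet$ and $v=C$ if $d=(C,u)$. - $(t,\mathsf{nt}\,n,g_2)$: all $(d,\varnothing)$ with $p\in g_2(n)$ and $(d,b)\in M_{ev}\,g_1\,(t,p,g_2\setminus(n,p))$ for some $b$. - All other cases: the empty list. (Each produced decomposition carries the evidently corresponding evidence.) -}

module Defs where

open import Data.Bool.Base using (if_then_else_)
open import Data.List.Base using (List; []; _∷_; [_]; _++_; map; mapMaybe; concatMap; filter; length; cartesianProduct)
open import Data.List.Membership.Propositional using (_∈_)
open import Data.List.Properties using (filter-notAll)
open import Data.List.Relation.Unary.All using (all?)
import Data.List.Relation.Unary.All as All
open import Data.List.Relation.Unary.Any using (here; there)
import Data.List.Relation.Unary.Any as Any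
import Data.List.Membership.Setoid as SetoidMembership
open import Data.Maybe.Base using (Maybe; just; nothing; _>>=_)
import Data.Maybe.Base as Maybe
open import Data.Nat.Base using (_<_)
open import Data.Nat.Induction using (<-wellFounded)
open import Data.Product.Base using (_×_; _,_; proj₁; proj₂; ∃; map₂; uncurry)
import Data.Product.Properties as Product
open import Data.Product.Relation.Binary.Pointwise.NonDependent using (×-setoid)
open import Data.Sum.Base using (_⊎_; inj₁; inj₂)
open import Function.Base using (_on_)
open import Induction.WellFounded using (Acc; acc; WellFounded)
open import Level using (0ℓ)
open import Relation.Binary.Bundles using (Setoid)
open import Relation.Binary.Construct.Closure.Transitive using (TransClosure; _∷ʳ_) renaming ([_] to [_]⁺; _++_ to _⁺++⁺_; wellFounded to ⁺-wellFounded)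
import Relation.Binary.Construct.On as On
open import Relation.Binary.Definitions using (DecidableEquality)
open import Relation.Binary.PropositionalEquality using (_≡_; refl; sym; cong; cong₂; _≗_; _→-setoid_; setoid)
open import Relation.Nullary.Decidable using (Dec; yes; no; does; map′; _×-dec_; ¬?)

record Signature : Set₁ where
  field
    Lit Var NonTerm : Set
    _≟ˡ_ : DecidableEquality Lit
    _≟ᵛ_ : DecidableEquality Var
    _≟ⁿ_ : DecidableEquality NonTerm

module Language (S : Signature) where
  open Signature S

  data Term     : Set
  data ListTerm : Set
  data Ctx      : Set
  data ListCtx  : Set

  data Term where
    lit  : Lit → Term
    list : ListTerm → Term
    ctx  : Ctx → Term

  data ListTerm where
    nil  : ListTerm
    cons : Term → ListTerm → ListTerm

  data Ctx where
    hole : Ctx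
    lctx : ListCtx → Ctx

  data ListCtx where
    hd : Ctx → ListTerm → ListCtx
    tl : Term → ListCtx → ListCtx

  data Pattern     : Set
  data ListPattern : Set

  data Pattern where
    lit     : Lit → Pattern
    hole    : Pattern
    list    : ListPattern → Pattern
    name    : Var → Pattern → Pattern
    nt      : NonTerm → Pattern
    in-hole : Pattern → Pattern → Pattern

  data ListPattern where
    nil  : ListPattern
    cons : Pattern → ListPattern → ListPattern

  _≟ᵗ_  : DecidableEquality Term
  _≟ˡᵗ_ : DecidableEquality ListTerm
  _≟ᶜ_  : DecidableEquality Ctx
  _≟ˡᶜ_ : DecidableEquality ListCtx

  lit a  ≟ᵗ lit a′  = map′ (cong lit) (λ { refl → refl }) (a ≟ˡ a′)
  list l ≟ᵗ list l′ = map′ (cong list) (λ { refl → refl }) (l ≟ˡᵗ l′)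
  ctx C  ≟ᵗ ctx C′  = map′ (cong ctx) (λ { refl → refl }) (C ≟ᶜ C′)
  lit _  ≟ᵗ list _  = no λ ()
  lit _  ≟ᵗ ctx _   = no λ ()
  list _ ≟ᵗ lit _   = no λ ()
  list _ ≟ᵗ ctx _   = no λ ()
  ctx _  ≟ᵗ lit _   = no λ ()
  ctx _  ≟ᵗ list _  = no λ ()

  nil      ≟ˡᵗ nil        = yes refl
  cons t l ≟ˡᵗ cons t′ l′ =
    map′ (uncurry (cong₂ cons)) (λ { refl → refl , refl }) ((t ≟ᵗ t′) ×-dec (l ≟ˡᵗ l′))
  nil      ≟ˡᵗ cons _ _   = no λ ()
  cons _ _ ≟ˡᵗ nil        = no λ ()

  hole   ≟ᶜ hole    = yes refl
  lctx L ≟ᶜ lctx L′ = map′ (cong lctx) (λ { refl → refl }) (L ≟ˡᶜ L′)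
  hole   ≟ᶜ lctx _  = no λ ()
  lctx _ ≟ᶜ hole    = no λ ()

  hd C l ≟ˡᶜ hd C′ l′ =
    map′ (uncurry (cong₂ hd)) (λ { refl → refl , refl }) ((C ≟ᶜ C′) ×-dec (l ≟ˡᵗ l′))
  tl t L ≟ˡᶜ tl t′ L′ =
    map′ (uncurry (cong₂ tl)) (λ { refl → refl , refl }) ((t ≟ᵗ t′) ×-dec (L ≟ˡᶜ L′))
  hd _ _ ≟ˡᶜ tl _ _   = no λ ()
  tl _ _ ≟ˡᶜ hd _ _   = no λ ()

  _≟ᵖ_  : DecidableEquality Pattern
  _≟ˡᵖ_ : DecidableEquality ListPattern

  lit a       ≟ᵖ lit a′        = map′ (cong lit) (λ { refl → refl }) (a ≟ˡ a′)
  hole        ≟ᵖ hole          = yes refl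
  list q      ≟ᵖ list q′       = map′ (cong list) (λ { refl → refl }) (q ≟ˡᵖ q′)
  name x p    ≟ᵖ name x′ p′    =
    map′ (uncurry (cong₂ name)) (λ { refl → refl , refl }) ((x ≟ᵛ x′) ×-dec (p ≟ᵖ p′))
  nt n        ≟ᵖ nt n′         = map′ (cong nt) (λ { refl → refl }) (n ≟ⁿ n′)
  in-hole p r ≟ᵖ in-hole p′ r′ =
    map′ (uncurry (cong₂ in-hole)) (λ { refl → refl , refl }) ((p ≟ᵖ p′) ×-dec (r ≟ᵖ r′))
  lit _       ≟ᵖ hole          = no λ ()
  lit _       ≟ᵖ list _        = no λ ()
  lit _       ≟ᵖ name _ _      = no λ ()
  lit _       ≟ᵖ nt _          = no λ ()
  lit _       ≟ᵖ in-hole _ _   = no λ ()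
  hole        ≟ᵖ lit _         = no λ ()
  hole        ≟ᵖ list _        = no λ ()
  hole        ≟ᵖ name _ _      = no λ ()
  hole        ≟ᵖ nt _          = no λ ()
  hole        ≟ᵖ in-hole _ _   = no λ ()
  list _      ≟ᵖ lit _         = no λ ()
  list _      ≟ᵖ hole          = no λ ()
  list _      ≟ᵖ name _ _      = no λ ()
  list _      ≟ᵖ nt _          = no λ ()
  list _      ≟ᵖ in-hole _ _   = no λ ()
  name _ _    ≟ᵖ lit _         = no λ ()
  name _ _    ≟ᵖ hole          = no λ ()
  name _ _    ≟ᵖ list _        = no λ ()
  name _ _    ≟ᵖ nt _          = no λ ()
  name _ _    ≟ᵖ in-hole _ _   = no λ ()
  nt _        ≟ᵖ lit _         = no λ ()
  nt _        ≟ᵖ hole          = no λ ()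
  nt _        ≟ᵖ list _        = no λ ()
  nt _        ≟ᵖ name _ _      = no λ ()
  nt _        ≟ᵖ in-hole _ _   = no λ ()
  in-hole _ _ ≟ᵖ lit _         = no λ ()
  in-hole _ _ ≟ᵖ hole          = no λ ()
  in-hole _ _ ≟ᵖ list _        = no λ ()
  in-hole _ _ ≟ᵖ name _ _      = no λ ()
  in-hole _ _ ≟ᵖ nt _          = no λ ()

  nil      ≟ˡᵖ nil        = yes refl
  cons p q ≟ˡᵖ cons p′ q′ =
    map′ (uncurry (cong₂ cons)) (λ { refl → refl , refl }) ((p ≟ᵖ p′) ×-dec (q ≟ˡᵖ q′))
  nil      ≟ˡᵖ cons _ _   = no λ ()
  cons _ _ ≟ˡᵖ nil        = no λ ()

  data Tail : Set where
    list : ListTerm → Tail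
    lctx : ListCtx → Tail

  tailTerm : Tail → Term
  tailTerm (list l) = list l
  tailTerm (lctx L) = ctx (lctx L)

  ⌊_⌋ᶜ : ListCtx → ListTerm
  ⌊ hd C l ⌋ᶜ = cons (ctx C) l
  ⌊ tl t L ⌋ᶜ = cons t ⌊ L ⌋ᶜ

  ⌊_⌋ : Tail → ListTerm
  ⌊ list l ⌋ = l
  ⌊ lctx L ⌋ = ⌊ L ⌋ᶜ

  -- Structured s t₁ t₂: s is structured with head t₁ and tail t₂.
  data Structured : Term → Term → Tail → Set where
    cons : ∀ {t l} → Structured (list (cons t l)) t (list l)
    hd   : ∀ {C l} → Structured (ctx (lctx (hd C l))) (ctx C) (list l)
    tl   : ∀ {t L} → Structured (ctx (lctx (tl t L))) t (lctx L)

  infix 4 _◁_ _<sub_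

  data _◁_ : Term → Term → Set where
    head : ∀ {s t₁ t₂} → Structured s t₁ t₂ → t₁ ◁ s
    tail : ∀ {s t₁ t₂} → Structured s t₁ t₂ → tailTerm t₂ ◁ s

  _<sub_ : Term → Term → Set
  _<sub_ = TransClosure _◁_

  infixr 5 _++ᶜ_ _++ˡ_

  _++ᶜ_ : Ctx → Ctx → Ctx
  _++ˡ_ : ListCtx → Ctx → ListCtx

  hole   ++ᶜ C′ = C′
  lctx L ++ᶜ C′ = lctx (L ++ˡ C′)

  hd C l ++ˡ C′ = hd (C ++ᶜ C′) l
  tl t L ++ˡ C′ = tl t (L ++ˡ C′)

  Production : Set
  Production = NonTerm × Pattern

  _≟ʳ_ : DecidableEquality Production
  _≟ʳ_ = Product.≡-dec _≟ⁿ_ _≟ᵖ_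

  -- The finite set of the elements of the list; order and repetitions carry
  -- no meaning, so _∖_ deletes every occurrence.
  Grammar : Set
  Grammar = List Production

  infixl 6 _∖_

  _∖_ : Grammar → Production → Grammar
  G ∖ r = filter (λ r′ → ¬? (r′ ≟ʳ r)) G

  -- A list of pairs stands for the finite partial function  lookup b, and two
  -- lists are the same binding set when they have the same lookup function.
  Bindings : Set
  Bindings = List (Var × Term)

  lookup : Bindings → Var → Maybe Term
  lookup []            x = nothing
  lookup ((y , t) ∷ b) x = if does (y ≟ᵛ x) then just t else lookup b x

  bindingsSetoid : Setoid 0ℓ 0ℓ
  bindingsSetoid = On.setoid (Var →-setoid Maybe Term) lookup

  infix 4 _≈_

  _≈_ : Bindings → Bindings → Set
  b ≈ b′ = lookup b ≗ lookup b′

  ∅ : Bindings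
  ∅ = []

  ⟦_↦_⟧ : Var → Term → Bindings
  ⟦ x ↦ t ⟧ = [ x , t ]

  AgreeAt : Bindings → Bindings → Var → Set
  AgreeAt b b′ x = ∀ t t′ → lookup b x ≡ just t → lookup b′ x ≡ just t′ → t ≡ t′

  Compatible : Bindings → Bindings → Set
  Compatible b b′ = ∀ x → AgreeAt b b′ x

  agreeAt? : ∀ b b′ x → Dec (AgreeAt b b′ x)
  agreeAt? b b′ x with lookup b x | lookup b′ x
  ... | nothing | _       = yes λ _ _ ()
  ... | just _  | nothing = yes λ _ _ _ ()
  ... | just t  | just t′ =
    map′ (λ { t≡t′ _ _ refl refl → t≡t′ }) (λ agree → agree t t′ refl refl) (t ≟ᵗ t′)

  lookup-∈ : ∀ b {x t} → lookup b x ≡ just t → x ∈ map proj₁ b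
  lookup-∈ ((y , _) ∷ b) {x} eq with y ≟ᵛ x
  ... | yes y≡x = here (sym y≡x)
  ... | no _    = there (lookup-∈ b eq)

  compatible? : ∀ b b′ → Dec (Compatible b b′)
  compatible? b b′ =
    map′ (λ agree x t t′ eq → All.lookup agree (lookup-∈ b eq) t t′ eq)
         (λ compatible → All.tabulate λ {x} _ → compatible x)
         (all? (agreeAt? b b′) (map proj₁ b))

  infixr 6 _⊔_

  _⊔_ : Bindings → Bindings → Maybe Bindings
  b ⊔ b′ = if does (compatible? b b′) then just (b ++ b′) else nothing

  infix 3 _⊢_∶_⟪_⟫∣_ _⊢_≐_[_]∶_⟪_⟫∣_

  -- The  resp  rules say only that the judgments are relations on binding
  -- sets, that is, on lists up to _≈_.

  data _⊢_∶_⟪_⟫∣_ (G : Grammar) : Term → Pattern → Grammar → Bindings → Set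

  data _⊢_≐_[_]∶_⟪_⟫∣_ (G : Grammar) : Term → Ctx → Term → Pattern → Grammar → Bindings → Set

  data _⊢_∶_⟪_⟫∣_ G where
    lit  : ∀ {a G′} → G ⊢ lit a ∶ lit a ⟪ G′ ⟫∣ ∅
    hole : ∀ {G′} → G ⊢ ctx hole ∶ hole ⟪ G′ ⟫∣ ∅
    nil  : ∀ {G′} → G ⊢ list nil ∶ list nil ⟪ G′ ⟫∣ ∅

    name : ∀ {t x p G′ b b′} →
           G ⊢ t ∶ p ⟪ G′ ⟫∣ b →
           b ⊔ ⟦ x ↦ t ⟧ ≡ just b′ →
           G ⊢ t ∶ name x p ⟪ G′ ⟫∣ b′

    nt   : ∀ {t n p G′ b} →
           (n , p) ∈ G′ →
           G ⊢ t ∶ p ⟪ G′ ∖ (n , p) ⟫∣ b →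
           G ⊢ t ∶ nt n ⟪ G′ ⟫∣ ∅

    cons : ∀ {s t₁ t₂ p₁ p₂ G′ b₁ b₂ b} →
           Structured s t₁ t₂ →
           G ⊢ t₁ ∶ p₁ ⟪ G ⟫∣ b₁ →
           G ⊢ tailTerm t₂ ∶ list p₂ ⟪ G ⟫∣ b₂ →
           b₁ ⊔ b₂ ≡ just b →
           G ⊢ s ∶ list (cons p₁ p₂) ⟪ G′ ⟫∣ b

    in-hole-sub : ∀ {t C u pᶜ pʰ G′ bᶜ bʰ b} →
           G ⊢ t ≐ C [ u ]∶ pᶜ ⟪ G′ ⟫∣ bᶜ →
           u <sub t →
           G ⊢ u ∶ pʰ ⟪ G ⟫∣ bʰ →
           bᶜ ⊔ bʰ ≡ just b →
           G ⊢ t ∶ in-hole pᶜ pʰ ⟪ G′ ⟫∣ b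

    in-hole-eq : ∀ {t pᶜ pʰ G′ bᶜ bʰ b} →
           G ⊢ t ≐ hole [ t ]∶ pᶜ ⟪ G′ ⟫∣ bᶜ →
           G ⊢ t ∶ pʰ ⟪ G′ ⟫∣ bʰ →
           bᶜ ⊔ bʰ ≡ just b →
           G ⊢ t ∶ in-hole pᶜ pʰ ⟪ G′ ⟫∣ b

    resp : ∀ {t p G′ b b′} →
           b ≈ b′ →
           G ⊢ t ∶ p ⟪ G′ ⟫∣ b →
           G ⊢ t ∶ p ⟪ G′ ⟫∣ b′

  data _⊢_≐_[_]∶_⟪_⟫∣_ G where
    hole : ∀ {t G′} → G ⊢ t ≐ hole [ t ]∶ hole ⟪ G′ ⟫∣ ∅

    cons-hd : ∀ {s t₁ t₂ C u p₁ p₂ G′ b₁ b₂ b} →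
           Structured s t₁ t₂ →
           G ⊢ t₁ ≐ C [ u ]∶ p₁ ⟪ G ⟫∣ b₁ →
           G ⊢ tailTerm t₂ ∶ list p₂ ⟪ G ⟫∣ b₂ →
           b₁ ⊔ b₂ ≡ just b →
           G ⊢ s ≐ lctx (hd C ⌊ t₂ ⌋) [ u ]∶ list (cons p₁ p₂) ⟪ G′ ⟫∣ b

    cons-tl : ∀ {s t₁ t₂ L u p₁ p₂ G′ b₁ b₂ b} →
           Structured s t₁ t₂ →
           G ⊢ t₁ ∶ p₁ ⟪ G ⟫∣ b₁ →
           G ⊢ tailTerm t₂ ≐ lctx L [ u ]∶ list p₂ ⟪ G ⟫∣ b₂ →
           b₁ ⊔ b₂ ≡ just b →
           G ⊢ s ≐ lctx (tl t₁ L) [ u ]∶ list (cons p₁ p₂) ⟪ G′ ⟫∣ b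

    nt   : ∀ {t C u n p G′ b} →
           (n , p) ∈ G′ →
           G ⊢ t ≐ C [ u ]∶ p ⟪ G′ ∖ (n , p) ⟫∣ b →
           G ⊢ t ≐ C [ u ]∶ nt n ⟪ G′ ⟫∣ ∅

    in-hole-sub : ∀ {t Cᶜ tᶜ Cʰ tʰ pᶜ pʰ G′ bᶜ bʰ b} →
           G ⊢ t ≐ Cᶜ [ tᶜ ]∶ pᶜ ⟪ G′ ⟫∣ bᶜ →
           tᶜ <sub t →
           G ⊢ tᶜ ≐ Cʰ [ tʰ ]∶ pʰ ⟪ G ⟫∣ bʰ →
           bᶜ ⊔ bʰ ≡ just b →
           G ⊢ t ≐ Cᶜ ++ᶜ Cʰ [ tʰ ]∶ in-hole pᶜ pʰ ⟪ G′ ⟫∣ b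

    in-hole-eq : ∀ {t Cʰ tʰ pᶜ pʰ G′ bᶜ bʰ b} →
           G ⊢ t ≐ hole [ t ]∶ pᶜ ⟪ G′ ⟫∣ bᶜ →
           G ⊢ t ≐ Cʰ [ tʰ ]∶ pʰ ⟪ G′ ⟫∣ bʰ →
           bᶜ ⊔ bʰ ≡ just b →
           G ⊢ t ≐ hole ++ᶜ Cʰ [ tʰ ]∶ in-hole pᶜ pʰ ⟪ G′ ⟫∣ b

    name : ∀ {t C u x p G′ b b′} →
           G ⊢ t ≐ C [ u ]∶ p ⟪ G′ ⟫∣ b →
           b ⊔ ⟦ x ↦ ctx C ⟧ ≡ just b′ →
           G ⊢ t ≐ C [ u ]∶ name x p ⟪ G′ ⟫∣ b′

    resp : ∀ {t C u p G′ b b′} →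
           b ≈ b′ →
           G ⊢ t ≐ C [ u ]∶ p ⟪ G′ ⟫∣ b →
           G ⊢ t ≐ C [ u ]∶ p ⟪ G′ ⟫∣ b′

  Evidence : Term → Ctx → Term → Set
  Evidence t C u = (u ≡ t × C ≡ hole) ⊎ u <sub t

  data Result (t : Term) : Set where
    •       : Result t
    ⟨_,_⟩^_ : ∀ C u → Evidence t C u → Result t

  Entry : Term → Set
  Entry t = Result t × Bindings

  module _ {t : Term} where
    open SetoidMembership (×-setoid (setoid (Result t)) bindingsSetoid) public
      using () renaming (_∈_ to _∈ᴱ_)

  refl-ev : ∀ {t} → Evidence t hole t
  refl-ev = inj₁ (refl , refl)

  child-ev : ∀ {s t C u} → t ◁ s → Evidence t C u → u <sub s
  child-ev t◁s (inj₁ (refl , _)) = [ t◁s ]⁺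
  child-ev t◁s (inj₂ u<t)        = u<t ∷ʳ t◁s

  compose-ev : ∀ {t C u C′ v} → Evidence t C u → Evidence u C′ v → Evidence t (C ++ᶜ C′) v
  compose-ev (inj₁ (refl , refl)) ev                = ev
  compose-ev (inj₂ u<t)           (inj₁ (refl , _)) = inj₂ u<t
  compose-ev (inj₂ u<t)           (inj₂ v<u)        = inj₂ (v<u ⁺++⁺ u<t)

  -- The tail is always matched against a list pattern, whose decompositions
  -- never have context  hole; the clause for  hole  only makes this total.
  consResult : ∀ {s t₁ t₂} → Structured s t₁ t₂ →
               Result t₁ → Result (tailTerm t₂) → Maybe (Result s)
  consResult σ •                • = just •
  consResult {t₂ = t₂} σ (⟨ C , u ⟩^ ev) • =
    just (⟨ lctx (hd C ⌊ t₂ ⌋) , u ⟩^ inj₂ (child-ev (head σ) ev))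
  consResult {t₁ = t₁} σ • (⟨ lctx L , u ⟩^ ev) =
    just (⟨ lctx (tl t₁ L) , u ⟩^ inj₂ (child-ev (tail σ) ev))
  consResult σ •                (⟨ hole , _ ⟩^ _) = nothing
  consResult σ (⟨ _ , _ ⟩^ _)   (⟨ _ , _ ⟩^ _)    = nothing

  consEntry : ∀ {s t₁ t₂} → Structured s t₁ t₂ →
              Entry t₁ × Entry (tailTerm t₂) → Maybe (Entry s)
  consEntry σ ((d₁ , b₁) , (d₂ , b₂)) =
    consResult σ d₁ d₂ >>= λ d → Maybe.map (d ,_) (b₁ ⊔ b₂)

  consEntries : ∀ {s t₁ t₂} → Structured s t₁ t₂ →
                List (Entry t₁) → List (Entry (tailTerm t₂)) → List (Entry s)
  consEntries σ es₁ es₂ = mapMaybe (consEntry σ) (cartesianProduct es₁ es₂)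

  plugResult : ∀ {t C u} → Evidence t C u → Result u → Result t
  plugResult         ev •                = •
  plugResult {C = C} ev (⟨ C′ , v ⟩^ ev′) = ⟨ C ++ᶜ C′ , v ⟩^ compose-ev ev ev′

  plugEntry : ∀ {t C u} → Evidence t C u → Bindings → Entry u → Maybe (Entry t)
  plugEntry ev bᶜ (dʰ , bʰ) = Maybe.map (plugResult ev dʰ ,_) (bᶜ ⊔ bʰ)

  holeEntries : ∀ {t C u} → List (Entry t) → (∀ {v} → v <sub t → List (Entry v)) →
                Evidence t C u → List (Entry u)
  holeEntries same below (inj₁ (refl , _)) = same
  holeEntries same below (inj₂ u<t)        = below u<t

  in-holeEntries : ∀ {t} → List (Entry t) → (∀ {v} → v <sub t → List (Entry v)) →
                   Entry t → List (Entry t)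
  in-holeEntries same below (• , _)               = []
  in-holeEntries same below ((⟨ C , u ⟩^ ev) , bᶜ) =
    mapMaybe (plugEntry ev bᶜ) (holeEntries same below ev)

  captured : ∀ {t} → Result t → Term
  captured {t} •              = t
  captured     (⟨ C , _ ⟩^ _) = ctx C

  nameEntry : ∀ {t} → Var → Entry t → Maybe (Entry t)
  nameEntry x (d , b) = Maybe.map (d ,_) (⟦ x ↦ captured d ⟧ ⊔ b)

  ntEntry : ∀ {t} → Entry t → Entry t
  ntEntry (d , _) = d , ∅

  productions : ∀ G n → List (∃ λ (p : Pattern) → (n , p) ∈ G)
  productions []             n = []
  productions ((n′ , p) ∷ G) n with n′ ≟ⁿ n
  ... | yes refl = (p , here refl) ∷ map (map₂ there) (productions G n)
  ... | no _     = map (map₂ there) (productions G n)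

  ◁-acc   : ∀ t → Acc _◁_ t
  ◁-accˡ  : ∀ l → Acc _◁_ (list l)
  ◁-accᶜ  : ∀ C → Acc _◁_ (ctx C)
  ◁-accˡᶜ : ∀ L → Acc _◁_ (ctx (lctx L))

  ◁-acc (lit _)  = acc λ { (head ()) ; (tail ()) }
  ◁-acc (list l) = ◁-accˡ l
  ◁-acc (ctx C)  = ◁-accᶜ C

  ◁-accˡ nil        = acc λ { (head ()) ; (tail ()) }
  ◁-accˡ (cons t l) = acc λ { (head cons) → ◁-acc t ; (tail cons) → ◁-accˡ l }

  ◁-accᶜ hole     = acc λ { (head ()) ; (tail ()) }
  ◁-accᶜ (lctx L) = ◁-accˡᶜ L

  ◁-accˡᶜ (hd C l) = acc λ { (head hd) → ◁-accᶜ C ; (tail hd) → ◁-accˡ l }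
  ◁-accˡᶜ (tl t L) = acc λ { (head tl) → ◁-acc t ; (tail tl) → ◁-accˡᶜ L }

  <sub-wellFounded : WellFounded _<sub_
  <sub-wellFounded = ⁺-wellFounded _◁_ ◁-acc

  infix 4 _⊏_

  _⊏_ : Grammar → Grammar → Set
  _⊏_ = _<_ on length

  ⊏-wellFounded : WellFounded _⊏_
  ⊏-wellFounded = On.wellFounded length <-wellFounded

  ∖-⊏ : ∀ G {r} → r ∈ G → G ∖ r ⊏ G
  ∖-⊏ G {r} r∈G =
    filter-notAll (λ r′ → ¬? (r′ ≟ʳ r)) G (Any.map (λ r≡r′ r′≢r → r′≢r (sym r≡r′)) r∈G)

  -- Recursion on the accessibility of t, then that of g₂, then on p.
  M : (g₁ : Grammar) (p : Pattern) (t : Term) (g₂ : Grammar) →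
      Acc _<sub_ t → Acc _⊏_ g₂ → List (Entry t)
  M g₁ hole (ctx hole) g₂ _ _ = ((⟨ hole , ctx hole ⟩^ refl-ev) , ∅) ∷ (• , ∅) ∷ []
  M g₁ hole t          g₂ _ _ = [ (⟨ hole , t ⟩^ refl-ev) , ∅ ]
  M g₁ (lit a) (lit a′) g₂ _ _ = if does (a ≟ˡ a′) then [ • , ∅ ] else []
  M g₁ (list nil) (list nil) g₂ _ _ = [ • , ∅ ]
  M g₁ (list (cons p₁ p₂)) (list (cons t l)) g₂ (acc ↓t) _ =
    consEntries cons
      (M g₁ p₁ t g₁ (↓t [ head cons ]⁺) (⊏-wellFounded g₁))
      (M g₁ (list p₂) (list l) g₁ (↓t [ tail cons ]⁺) (⊏-wellFounded g₁))
  M g₁ (list (cons p₁ p₂)) (ctx (lctx (hd C l))) g₂ (acc ↓t) _ =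
    consEntries hd
      (M g₁ p₁ (ctx C) g₁ (↓t [ head hd ]⁺) (⊏-wellFounded g₁))
      (M g₁ (list p₂) (list l) g₁ (↓t [ tail hd ]⁺) (⊏-wellFounded g₁))
  M g₁ (list (cons p₁ p₂)) (ctx (lctx (tl t L))) g₂ (acc ↓t) _ =
    consEntries tl
      (M g₁ p₁ t g₁ (↓t [ head tl ]⁺) (⊏-wellFounded g₁))
      (M g₁ (list p₂) (ctx (lctx L)) g₁ (↓t [ tail tl ]⁺) (⊏-wellFounded g₁))
  M g₁ (in-hole pᶜ pʰ) t g₂ at@(acc ↓t) ag =
    concatMap
      (in-holeEntries
        (M g₁ pʰ t g₂ at ag)
        (λ {v} v<t → M g₁ pʰ v g₁ (↓t v<t) (⊏-wellFounded g₁)))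
      (M g₁ pᶜ t g₂ at ag)
  M g₁ (name x p) t g₂ at ag = mapMaybe (nameEntry x) (M g₁ p t g₂ at ag)
  M g₁ (nt n) t g₂ at (acc ↓g) =
    concatMap
      (λ (p , r∈g₂) → map ntEntry (M g₁ p t (g₂ ∖ (n , p)) at (↓g (∖-⊏ g₂ r∈g₂))))
      (productions g₂ n)
  M _ _ _ _ _ _ = []

  M-ev : Grammar → ((t , _ , _) : Term × Pattern × Grammar) → List (Entry t)
  M-ev g₁ (t , p , g₂) = M g₁ p t g₂ (<sub-wellFounded t) (⊏-wellFounded g₂)

{-# OPTIONS --safe #-}
module Submission where

open import Defs
open import Data.Bool.Base using (if_then_else_)
open import Data.Product.Base using (_×_; _,_; proj₁; proj₂; Σ-syntax)
open import Data.List.Base using (List; []; _∷_; _++_)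
open import Data.List.Membership.Propositional using (_∈_)
open import Data.List.Relation.Unary.All using (All; []; _∷_)
import Data.List.Relation.Unary.All as All
import Data.List.Relation.Unary.All.Properties as AllP
open import Data.Maybe.Base using (Maybe; just; nothing; _<∣>_)
import Data.Maybe.Relation.Unary.All as Maybe
import Data.Maybe.Relation.Unary.All.Properties as MaybeP
open import Data.Sum.Base using (inj₁; inj₂)
open import Function.Base using (_∘_)
open import Induction.WellFounded using (Acc; acc)
open import Relation.Binary.Construct.Closure.Transitive using () renaming ([_] to [_]⁺)
open import Relation.Binary.PropositionalEquality using (_≡_; refl; sym; cong; setoid)
open import Relation.Nullary.Decidable using (Dec; yes; no; does; dec-true)

-- The algorithm mirrors the rules: each way of producing an entry corresponds to one rule, and the
-- entries it combines supply that rule's premises. Matches must be treated together with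
-- decompositions, because matching `in-hole` calls decomposition and decomposing a `cons` calls
-- matching. So `Sound` assigns to every entry the judgment it claims, and `M-sound` shows, by the
-- algorithm's own well-founded recursion, that all entries of the list satisfy it. The combinators
-- `consEntry`, `plugEntry`, `nameEntry` and `ntEntry` each preserve `Sound`.
--
-- Beyond this correspondence, only the representation of binding sets needs an argument. In the
-- `name` case the algorithm and the rule take the union in opposite orders, which is settled by
-- `⊔-comm`; and membership of an entry is itself up to `_≈_`, which is settled by `Sound-resp`.

-- Keeps the equation `m ≡ just x`; with `m` a union, this is exactly the definedness premise of the
-- rules.
tabulateᵐ : ∀ {a p} {A : Set a} {P : A → Set p} (m : Maybe A) →
            (∀ {x} → m ≡ just x → P x) → Maybe.All P m
tabulateᵐ (just _) f = Maybe.just (f refl)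
tabulateᵐ nothing  f = Maybe.nothing

module _ {a p} {A : Set a} {P : Set p} {x : A} where

  if-does-just : ∀ {y} (P? : Dec P) → (if does P? then just x else nothing) ≡ just y → P × x ≡ y
  if-does-just (yes p) refl = p , refl

  if-does-true : (P? : Dec P) → P → (if does P? then just x else nothing) ≡ just x
  if-does-true P? p = cong (if_then just x else nothing) (dec-true P? p)

module Soundness (S : Signature) where
  open Signature S
  open Language S

  lookup-++ : ∀ b b′ x → lookup (b ++ b′) x ≡ (lookup b x <∣> lookup b′ x)
  lookup-++ []            b′ x = refl
  lookup-++ ((y , _) ∷ b) b′ x with y ≟ᵛ x
  ... | yes _ = refl
  ... | no _  = lookup-++ b b′ x

  -- Lookup in `b ++ b′` prefers `b`, so the order matters only at variables bound on both sides,
  -- and there compatibility equates the two values.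
  ++-comm : ∀ b b′ → Compatible b b′ → b ++ b′ ≈ b′ ++ b
  ++-comm b b′ b∥b′ x
    rewrite lookup-++ b b′ x | lookup-++ b′ b x
    with lookup b x | lookup b′ x | b∥b′ x
  ... | nothing | nothing | _     = refl
  ... | nothing | just _  | _     = refl
  ... | just _  | nothing | _     = refl
  ... | just t  | just t′ | agree = cong just (agree t t′ refl refl)

  ⊔-comm : ∀ b b′ {c} → b ⊔ b′ ≡ just c → Σ[ c′ ∈ Bindings ] (b′ ⊔ b ≡ just c′ × c′ ≈ c)
  ⊔-comm b b′ eq with if-does-just (compatible? b b′) eq
  ... | b∥b′ , refl = b′ ++ b , if-does-true (compatible? b′ b) b′∥b , ++-comm b′ b b′∥b
    where
    b′∥b : Compatible b′ b
    b′∥b x t t′ eq eq′ = sym (b∥b′ x t′ t eq′ eq)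

  -- A single predicate for both halves of the theorem, so that one induction proves them
  -- simultaneously. The evidence is ignored: it only selects which `in-hole` rule applies.
  Sound : Grammar → Pattern → Grammar → ∀ {t} → Entry t → Set
  Sound G p G′ {t} (• , b)              = G ⊢ t ∶ p ⟪ G′ ⟫∣ b
  Sound G p G′ {t} ((⟨ C , u ⟩^ _) , b) = G ⊢ t ≐ C [ u ]∶ p ⟪ G′ ⟫∣ b

  consEntry-sound : ∀ {G G′ p₁ p₂ s t₁ t₂} (σ : Structured s t₁ t₂) →
                    ∀ e₁ e₂ → Sound G p₁ G e₁ → Sound G (list p₂) G e₂ →
                    Maybe.All (Sound G (list (cons p₁ p₂)) G′) (consEntry σ (e₁ , e₂))
  consEntry-sound σ (• , b₁) (• , b₂) h₁ h₂ =
    MaybeP.map⁺ (tabulateᵐ (b₁ ⊔ b₂) (cons σ h₁ h₂))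
  consEntry-sound σ ((⟨ _ , _ ⟩^ _) , b₁) (• , b₂) h₁ h₂ =
    MaybeP.map⁺ (tabulateᵐ (b₁ ⊔ b₂) (cons-hd σ h₁ h₂))
  consEntry-sound σ (• , b₁) ((⟨ lctx _ , _ ⟩^ _) , b₂) h₁ h₂ =
    MaybeP.map⁺ (tabulateᵐ (b₁ ⊔ b₂) (cons-tl σ h₁ h₂))
  -- `consResult` yields no entry in the last two cases, so the claim is vacuous.
  consEntry-sound σ (• , _) ((⟨ hole , _ ⟩^ _) , _) h₁ h₂ = Maybe.nothing
  consEntry-sound σ ((⟨ _ , _ ⟩^ _) , _) ((⟨ _ , _ ⟩^ _) , _) h₁ h₂ = Maybe.nothing

  consEntries-sound : ∀ {G G′ p₁ p₂ s t₁ t₂} (σ : Structured s t₁ t₂) →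
                      ∀ {es₁ es₂} →
                      All (Sound G p₁ G) es₁ → All (Sound G (list p₂) G) es₂ →
                      All (Sound G (list (cons p₁ p₂)) G′) (consEntries σ es₁ es₂)
  consEntries-sound σ {es₁} {es₂} hs₁ hs₂ =
    AllP.mapMaybe⁺ (AllP.map⁺
      (AllP.cartesianProduct⁺ (setoid _) (setoid _) es₁ es₂ λ e₁∈ e₂∈ →
        consEntry-sound σ _ _ (All.lookup hs₁ e₁∈) (All.lookup hs₂ e₂∈)))

  plugEntry-sub-sound : ∀ {G G′ pᶜ pʰ t C u bᶜ} (u<t : u <sub t) →
                        G ⊢ t ≐ C [ u ]∶ pᶜ ⟪ G′ ⟫∣ bᶜ →
                        ∀ e → Sound G pʰ G e →
                        Maybe.All (Sound G (in-hole pᶜ pʰ) G′) (plugEntry {C = C} (inj₂ u<t) bᶜ e)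
  plugEntry-sub-sound {bᶜ = bᶜ} u<t hᶜ (• , bʰ) hʰ =
    MaybeP.map⁺ (tabulateᵐ (bᶜ ⊔ bʰ) (in-hole-sub hᶜ u<t hʰ))
  plugEntry-sub-sound {bᶜ = bᶜ} u<t hᶜ ((⟨ _ , _ ⟩^ _) , bʰ) hʰ =
    MaybeP.map⁺ (tabulateᵐ (bᶜ ⊔ bʰ) (in-hole-sub hᶜ u<t hʰ))

  plugEntry-eq-sound : ∀ {G G′ pᶜ pʰ t bᶜ} →
                       G ⊢ t ≐ hole [ t ]∶ pᶜ ⟪ G′ ⟫∣ bᶜ →
                       ∀ e → Sound G pʰ G′ e →
                       Maybe.All (Sound G (in-hole pᶜ pʰ) G′)
                                 (plugEntry {C = hole} (inj₁ (refl , refl)) bᶜ e)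
  plugEntry-eq-sound {bᶜ = bᶜ} hᶜ (• , bʰ) hʰ =
    MaybeP.map⁺ (tabulateᵐ (bᶜ ⊔ bʰ) (in-hole-eq hᶜ hʰ))
  plugEntry-eq-sound {bᶜ = bᶜ} hᶜ ((⟨ _ , _ ⟩^ _) , bʰ) hʰ =
    MaybeP.map⁺ (tabulateᵐ (bᶜ ⊔ bʰ) (in-hole-eq hᶜ hʰ))

  -- The two forms of evidence match the two `in-hole` rules. If the decomposition consumed nothing,
  -- `pʰ` is run with the remaining grammar `G′`; on a proper sub-term it restarts from the full
  -- grammar `G`.
  in-holeEntries-sound : ∀ {G G′ pᶜ pʰ t} {same : List (Entry t)}
                         {below : ∀ {v} → v <sub t → List (Entry v)} →
                         All (Sound G pʰ G′) same →
                         (∀ {v} (v<t : v <sub t) → All (Sound G pʰ G) (below v<t)) →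
                         ∀ e → Sound G pᶜ G′ e →
                         All (Sound G (in-hole pᶜ pʰ) G′) (in-holeEntries same below e)
  in-holeEntries-sound same-sound below-sound (• , _) h = []
  in-holeEntries-sound same-sound below-sound ((⟨ _ , _ ⟩^ inj₁ (refl , refl)) , _) h =
    AllP.mapMaybe⁺ (AllP.gmap⁺ (plugEntry-eq-sound h _) same-sound)
  in-holeEntries-sound same-sound below-sound ((⟨ _ , _ ⟩^ inj₂ u<t) , _) h =
    AllP.mapMaybe⁺ (AllP.gmap⁺ (plugEntry-sub-sound u<t h _) (below-sound u<t))

  -- The algorithm and the judgment form the union in opposite orders, which as
  -- lists agree only up to _≈_.
  nameEntry-sound : ∀ {G G′ p t} x (e : Entry t) → Sound G p G′ e →
                    Maybe.All (Sound G (name x p) G′) (nameEntry x e)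
  nameEntry-sound x (• , b) h = MaybeP.map⁺ (tabulateᵐ (⟦ x ↦ _ ⟧ ⊔ b) λ eq →
    let _ , eq′ , c′≈c = ⊔-comm ⟦ x ↦ _ ⟧ b eq in resp c′≈c (name h eq′))
  nameEntry-sound x ((⟨ C , _ ⟩^ _) , b) h = MaybeP.map⁺ (tabulateᵐ (⟦ x ↦ ctx C ⟧ ⊔ b) λ eq →
    let _ , eq′ , c′≈c = ⊔-comm ⟦ x ↦ ctx C ⟧ b eq in resp c′≈c (name h eq′))

  ntEntry-sound : ∀ {G G′ n p t} → (n , p) ∈ G′ → (e : Entry t) →
                  Sound G p (G′ ∖ (n , p)) e → Sound G (nt n) G′ (ntEntry e)
  ntEntry-sound r∈G′ (• , _)              h = nt r∈G′ h
  ntEntry-sound r∈G′ ((⟨ _ , _ ⟩^ _) , _) h = nt r∈G′ h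

  -- Stated for arbitrary accessibility proofs, so that the induction hypotheses apply to the
  -- recursive calls exactly as `M` makes them.
  M-sound : ∀ g₁ p t g₂ (at : Acc _<sub_ t) (ag : Acc _⊏_ g₂) →
            All (Sound g₁ p g₂) (M g₁ p t g₂ at ag)
  -- The term is split into all its forms because the overlapping clauses of `M` reduce only once
  -- its constructors are known.
  M-sound g₁ hole (ctx hole)     g₂ _ _ = hole ∷ hole ∷ []
  M-sound g₁ hole (ctx (lctx _)) g₂ _ _ = hole ∷ []
  M-sound g₁ hole (lit _)        g₂ _ _ = hole ∷ []
  M-sound g₁ hole (list _)       g₂ _ _ = hole ∷ []
  M-sound g₁ (lit a) (lit a′) g₂ _ _ with a ≟ˡ a′
  ... | yes refl = lit ∷ []
  ... | no _     = []
  M-sound g₁ (lit a) (list _) g₂ _ _ = []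
  M-sound g₁ (lit a) (ctx _)  g₂ _ _ = []
  M-sound g₁ (list nil) (list nil)        g₂ _ _ = nil ∷ []
  M-sound g₁ (list nil) (list (cons _ _)) g₂ _ _ = []
  M-sound g₁ (list nil) (lit _)           g₂ _ _ = []
  M-sound g₁ (list nil) (ctx _)           g₂ _ _ = []
  M-sound g₁ (list (cons p₁ p₂)) (list (cons t l)) g₂ (acc ↓t) _ =
    consEntries-sound cons
      (M-sound g₁ p₁ t g₁ (↓t [ head cons ]⁺) (⊏-wellFounded g₁))
      (M-sound g₁ (list p₂) (list l) g₁ (↓t [ tail cons ]⁺) (⊏-wellFounded g₁))
  M-sound g₁ (list (cons p₁ p₂)) (ctx (lctx (hd C l))) g₂ (acc ↓t) _ =
    consEntries-sound hd
      (M-sound g₁ p₁ (ctx C) g₁ (↓t [ head hd ]⁺) (⊏-wellFounded g₁))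
      (M-sound g₁ (list p₂) (list l) g₁ (↓t [ tail hd ]⁺) (⊏-wellFounded g₁))
  M-sound g₁ (list (cons p₁ p₂)) (ctx (lctx (tl t L))) g₂ (acc ↓t) _ =
    consEntries-sound tl
      (M-sound g₁ p₁ t g₁ (↓t [ head tl ]⁺) (⊏-wellFounded g₁))
      (M-sound g₁ (list p₂) (ctx (lctx L)) g₁ (↓t [ tail tl ]⁺) (⊏-wellFounded g₁))
  M-sound g₁ (list (cons _ _)) (lit _)    g₂ _ _ = []
  M-sound g₁ (list (cons _ _)) (list nil) g₂ _ _ = []
  M-sound g₁ (list (cons _ _)) (ctx hole) g₂ _ _ = []
  M-sound g₁ (in-hole pᶜ pʰ) t g₂ at@(acc ↓t) ag =
    AllP.concat⁺ (AllP.gmap⁺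
      (in-holeEntries-sound
        (M-sound g₁ pʰ t g₂ at ag)
        (λ {v} v<t → M-sound g₁ pʰ v g₁ (↓t v<t) (⊏-wellFounded g₁))
        _)
      (M-sound g₁ pᶜ t g₂ at ag))
  M-sound g₁ (name x p) t g₂ at ag =
    AllP.mapMaybe⁺ (AllP.gmap⁺ (nameEntry-sound x _) (M-sound g₁ p t g₂ at ag))
  M-sound g₁ (nt n) t g₂ at (acc ↓g) =
    AllP.concat⁺ (AllP.map⁺ (All.universal
      -- The membership proof carried by each production serves twice: as the premise of the `nt`
      -- rule and as the reason the grammar shrinks.
      (λ (p , r∈g₂) → AllP.gmap⁺ (ntEntry-sound r∈g₂ _)
        (M-sound g₁ p t (g₂ ∖ (n , p)) at (↓g (∖-⊏ g₂ r∈g₂))))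
      (productions g₂ n)))

  Sound-resp : ∀ {G p G′ t} {d : Result t} {b e} → d ≡ proj₁ e × b ≈ proj₂ e →
               Sound G p G′ e → Sound G p G′ (d , b)
  Sound-resp {d = •}            (refl , b≈b′) h = resp (sym ∘ b≈b′) h
  Sound-resp {d = ⟨ _ , _ ⟩^ _} (refl , b≈b′) h = resp (sym ∘ b≈b′) h

  M-ev-sound : ∀ {G p G′ t} (e : Entry t) → e ∈ᴱ M-ev G (t , p , G′) → Sound G p G′ e
  M-ev-sound {G} {p} {G′} {t} e e∈ =
    -- `h` concerns the entry actually in the list, whose binding set may be a different list from
    -- that of `e`; `Sound-resp` transfers the result.
    let h , e≈e′ = All.lookupAny (M-sound G p t G′ (<sub-wellFounded t) (⊏-wellFounded G′)) e∈
    in Sound-resp e≈e′ h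

theorem2 : (S : Signature) → let open Language S in
    (G₁ G₂ : Grammar) (p : Pattern) (t u : Term) (b : Bindings) (C : Ctx) →
    ((• , b) ∈ᴱ M-ev G₁ (t , p , G₂) → G₁ ⊢ t ∶ p ⟪ G₂ ⟫∣ b)
    × ((Σ[ ev ∈ Evidence t C u ] ((⟨ C , u ⟩^ ev) , b) ∈ᴱ M-ev G₁ (t , p , G₂)) →
    G₁ ⊢ t ≐ C [ u ]∶ p ⟪ G₂ ⟫∣ b)
theorem2 S G₁ G₂ p t u b C = M-ev-sound _ , λ (_ , e∈) → M-ev-sound _ e∈
  where open Soundness S
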